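{- Let $d \ge 1$ and let $(S,T;\phi)$ be a matched pair in $\{0,1\}^d$ with $S \cap T = \emptyset$. Then there exist $|S|$ pairwise edge-disjoint directed paths in the directed $d$-dimensional hypercube, each starting at a vertex of $S$ and ending at a vertex of $T$.
   Context: The directed $d$-dimensional hypercube has vertex set $\{0,1\}^d$ and a directed edge $(x,y)$ whenever $x$ and $y$ differ in exactly one coordinate and $y$ has one more $1$ than $x$ (so directed paths are monotone). Write $x \prec y$ if $x \ne y$ and $x_i \le y_i$ for all $i$. A matched pair $(S,T;\phi)$ consists of sets $S,T \subseteq \{0,1\}^d$ and a bijection $\phi:S\to T$ with $s \prec \phi(s)$ for all $s \in S$. -}

module Defs where

open import Data.Bool using (Bool; true; false; _≤_)
open import Data.Nat using (ℕ)
open import Data.Empty using (⊥)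
open import Data.Fin using (Fin)
open import Data.Vec using (Vec; lookup; _[_]≔_)
open import Data.List using (List; []; _∷_; map; concat; length)
open import Data.List.Membership.Propositional using (_∈_)
open import Data.List.Relation.Unary.Unique.Propositional using (Unique)
open import Data.List.Relation.Unary.All using (All)
open import Data.Product using (Σ; _×_; _,_)
open import Relation.Binary.PropositionalEquality using (_≡_; _≢_)

Vertex : ℕ → Set
Vertex d = Vec Bool d

DEdge : {d : ℕ} → Vertex d → Vertex d → Set
DEdge {d} x y = Σ (Fin d) λ i → (lookup x i ≡ false) × (y ≡ x [ i ]≔ true)

_≺_ : {d : ℕ} → Vertex d → Vertex d → Set
_≺_ {d} x y = (x ≢ y) × ((i : Fin d) → lookup x i ≤ lookup y i)

data Path {d : ℕ} : Vertex d → Vertex d → Set where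
  [_]  : (x : Vertex d) → Path x x
  _▸_  : {x y z : Vertex d} → DEdge x y → Path y z → Path x z

edges : {d : ℕ} {x y : Vertex d} → Path x y → List (Vertex d × Vertex d)
edges [ x ] = []
edges {x = x} (_▸_ {y = y} e p) = (x , y) ∷ edges p

SomePath : ℕ → Set
SomePath d = Σ (Vertex d) λ x → Σ (Vertex d) λ y → Path x y

start : {d : ℕ} → SomePath d → Vertex d
start (x , _ , _) = x

end : {d : ℕ} → SomePath d → Vertex d
end (_ , y , _) = y

pathEdges : {d : ℕ} → SomePath d → List (Vertex d × Vertex d)
pathEdges (_ , _ , p) = edges p

-- A family of paths is pairwise edge-disjoint (and no path repeats an edge) iff the
-- concatenation of their edge lists has no duplicates.
EdgeDisjoint : {d : ℕ} → List (SomePath d) → Set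
EdgeDisjoint ps = Unique (concat (map pathEdges ps))

-- Matched pair (S, T; φ): S is a duplicate-free list (a finite set), φ is injective on S
-- (so T = φ(S) is a set of size |S| and φ : S → T is a bijection), and s ≺ φ s.
record MatchedPair (d : ℕ) : Set where
  field
    S       : List (Vertex d)
    φ       : Vertex d → Vertex d
    S-set   : Unique S
    φ-inj   : Unique (map φ S)
    φ-above : All (λ s → s ≺ φ s) S

  T : List (Vertex d)
  T = map φ S

Disjoint : {d : ℕ} → List (Vertex d) → List (Vertex d) → Set
Disjoint A B = ∀ {v} → v ∈ A → v ∈ B → ⊥

{-# OPTIONS --safe #-}

-- The proof combines max-flow/min-cut with a lower bound on directed cuts.
--
-- Cuts.  A set of vertices containing S and avoiding T is a Boolean function f that is
-- true on S and false on T.  Every f differs from some monotone g in at most as many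
-- points as f has decreasing edges, and a monotone g differs from f in at least one
-- point of every pair (s , φ s); hence the cut has at least |S| edges.  The existence of
-- g goes by induction on the dimension: if g₀ and g₁ approximate the two halves f₀ and
-- f₁ of f, then (g₀ ∧ g₁ , g₁) and (g₀ , g₀ ∨ g₁) are monotone, and their errors exceed
-- the sum of those of g₀ and g₁ by amounts adding up to at most 2 |f₀ ∖ f₁|.
--
-- Flows.  A flow is a set of used edges whose boundary is a list of sources minus a list
-- of sinks, an equation stated without subtraction as a permutation.  It is augmented as
-- in the Ford–Fulkerson method and finally decomposed into paths.
module Submission where

open import Defs
open import Data.Bool using (Bool; true; false; _∧_; _∨_; not; _xor_; b≤b)
import Data.Bool as Bool
import Data.Bool.Properties as Bool
open import Data.Empty using (⊥; ⊥-elim)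
open import Data.Fin using (zero; suc)
open import Data.List using (List; []; _∷_; _++_; map; concat; length)
open import Data.List.Membership.Propositional using (_∈_; _∉_; find; lose)
open import Data.List.Membership.Propositional.Properties using (∈-∃++; ∈-++⁺ˡ; ∈-++⁺ʳ; ∈-++⁻; ∈-map⁺; ∈-map⁻)
open import Data.List.Properties using (map-++; map-∘; map-cong-local)
open import Data.List.Relation.Binary.Permutation.Propositional using (_↭_; ↭-refl; ↭-sym; ↭-trans; prep; swap; ↭⇒↭ₛ; module PermutationReasoning)
open import Data.List.Relation.Binary.Permutation.Propositional.Properties using (∈-resp-↭; All-resp-↭; ↭-length; shift; drop-∷; ++⁺ˡ; ++⁺ʳ; map⁺; ++-assoc)
open import Data.List.Relation.Binary.Permutation.Setoid.Properties using (Unique-resp-↭)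
open import Data.List.Relation.Unary.All as All using (All; []; _∷_)
import Data.List.Relation.Unary.All.Properties as All
open import Data.List.Relation.Unary.AllPairs using ([]; _∷_)
open import Data.List.Relation.Unary.Any using (here; there; any?)
open import Data.List.Relation.Unary.Unique.Propositional using (Unique)
import Data.List.Relation.Unary.Unique.Propositional.Properties as Unique
open import Data.Nat using (ℕ; zero; suc; _+_; _≤_; _<_; _≥_; z≤n; s≤s; _≤?_; _≤ᵇ_)
open import Data.Nat.ListAction using (sum)
open import Data.Nat.ListAction.Properties using (sum-++; sum-↭)
open import Data.Nat.Properties
open import Algebra.Properties.CommutativeSemigroup +-commutativeSemigroup using (interchange)
open import Data.Product using (Σ; ∃-syntax; _×_; _,_; proj₁; proj₂)
open import Data.Sum using (_⊎_; inj₁; inj₂)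
open import Data.Vec using ([]; _∷_; lookup)
import Data.Vec.Properties as Vec
open import Function using (_∘_)
open import Relation.Binary.Definitions using (DecidableEquality)
open import Relation.Binary.PropositionalEquality using (_≡_; refl; sym; trans; cong; cong₂; subst; setoid; module ≡-Reasoning)
open import Relation.Nullary using (¬_; yes; no; ¬?; _×-dec_)
open import Relation.Nullary.Decidable using (does; decidable-stable; dec-true; dec-false)

private
  variable
    X Y : Set

∈⇒↭ : {x : X} {xs : List X} → x ∈ xs → ∃[ ys ] xs ↭ x ∷ ys
∈⇒↭ {x = x} x∈xs with ∈-∃++ x∈xs
... | ys , zs , refl = ys ++ zs , shift x ys zs

-- Sums over lists

∑ : List X → (X → ℕ) → ℕ
∑ xs h = sum (map h xs)

⟦_⟧ : Bool → ℕ
⟦ false ⟧ = 0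
⟦ true  ⟧ = 1

∑-++ : (h : X → ℕ) (xs ys : List X) → ∑ (xs ++ ys) h ≡ ∑ xs h + ∑ ys h
∑-++ h xs ys = trans (cong sum (map-++ h xs ys)) (sum-++ (map h xs) (map h ys))

∑-map : (h : Y → ℕ) (k : X → Y) (xs : List X) → ∑ (map k xs) h ≡ ∑ xs (h ∘ k)
∑-map h k xs = cong sum (sym (map-∘ xs))

∑-↭ : (h : X → ℕ) {xs ys : List X} → xs ↭ ys → ∑ xs h ≡ ∑ ys h
∑-↭ h p = sum-↭ (map⁺ h p)

∑-cong : {h k : X → ℕ} {xs : List X} → All (λ x → h x ≡ k x) xs → ∑ xs h ≡ ∑ xs k
∑-cong eqs = cong sum (map-cong-local eqs)

∑-+ : (h k : X → ℕ) (xs : List X) → ∑ xs (λ x → h x + k x) ≡ ∑ xs h + ∑ xs k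
∑-+ h k []       = refl
∑-+ h k (x ∷ xs) =
  trans (cong (h x + k x +_) (∑-+ h k xs)) (interchange (h x) (k x) (∑ xs h) (∑ xs k))

∑-mono : {h k : X → ℕ} {xs : List X} → All (λ x → h x ≤ k x) xs → ∑ xs h ≤ ∑ xs k
∑-mono []         = z≤n
∑-mono (le ∷ les) = +-mono-≤ le (∑-mono les)

∑-zero : {h : X → ℕ} {xs : List X} → All (λ x → h x ≡ 0) xs → ∑ xs h ≡ 0
∑-zero []         = refl
∑-zero (eq ∷ eqs) = cong₂ _+_ eq (∑-zero eqs)

∑-one : {h : X → ℕ} {xs : List X} → All (λ x → h x ≡ 1) xs → ∑ xs h ≡ length xs
∑-one []         = refl
∑-one (eq ∷ eqs) = cong₂ _+_ eq (∑-one eqs)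

-- Each entry of `xs` claims an occurrence of its own in `ys`. Deleting that occurrence keeps the
-- later entries available, since uniqueness makes them different from `x`.
∑-⊆ : (h : X → ℕ) {xs ys : List X} → Unique xs → (∀ {x} → x ∈ xs → x ∈ ys) →
      ∑ xs h ≤ ∑ ys h
∑-⊆ h {[]}     {ys} _        _     = z≤n
∑-⊆ h {x ∷ xs} {ys} (x≢ ∷ u) xs⊆ys with ∈⇒↭ (xs⊆ys (here refl))
... | zs , p = begin
  h x + ∑ xs h  ≤⟨ +-monoʳ-≤ (h x) (∑-⊆ h u sub) ⟩
  h x + ∑ zs h  ≡⟨ ∑-↭ h p ⟨
  ∑ ys h        ∎
  where
  open ≤-Reasoning
  sub : ∀ {z} → z ∈ xs → z ∈ zs
  sub z∈xs with ∈-resp-↭ p (xs⊆ys (there z∈xs))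
  ... | here refl  = ⊥-elim (All.lookup x≢ z∈xs refl)
  ... | there z∈zs = z∈zs

-- Flows in a finite directed graph

module Flow {V : Set} (_≟_ : DecidableEquality V)
            (vertices : List V) (complete : ∀ v → v ∈ vertices)
            (E : List (V × V)) where

  open import Data.List.Membership.DecPropositional _≟_ using (_∈?_)

  Edge : Set
  Edge = V × V

  cutEdge : (V → Bool) → Edge → Bool
  cutEdge f (u , v) = f u ∧ not (f v)

  -- Splitting `E` up to permutation enforces unit capacities. `balance` compares multiplicities: at
  -- each vertex, out-degree in `used` plus occurrences in `ts` equals in-degree plus occurrences in
  -- `ss`.
  record FlowBetween (ss ts : List V) : Set where
    field
      used unused : List Edge
      partition   : used ++ unused ↭ E
      balance     : map proj₁ used ++ ts ↭ map proj₂ used ++ ss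

  open FlowBetween

  -- Using the edge adds a tail `u` and a head `v`, so replacing the sink `u` by `v` restores the
  -- balance.
  forward : ∀ {ss ts u v} (C : FlowBetween ss (u ∷ ts)) {U} →
            unused C ↭ (u , v) ∷ U → FlowBetween ss (v ∷ ts)
  forward {ss} {ts} {u} {v} C {U} p = record
    { used      = (u , v) ∷ used C
    ; unused    = U
    ; partition = begin
        (u , v) ∷ used C ++ U    ↭⟨ shift (u , v) (used C) U ⟨
        used C ++ (u , v) ∷ U    ↭⟨ ++⁺ˡ (used C) p ⟨
        used C ++ unused C       ↭⟨ partition C ⟩
        E                        ∎
    ; balance   = begin
        u ∷ map proj₁ (used C) ++ v ∷ ts  ↭⟨ prep u (shift v (map proj₁ (used C)) ts) ⟩
        u ∷ v ∷ map proj₁ (used C) ++ ts  ↭⟨ swap u v ↭-refl ⟩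
        v ∷ u ∷ map proj₁ (used C) ++ ts  ↭⟨ prep v (shift u (map proj₁ (used C)) ts) ⟨
        v ∷ map proj₁ (used C) ++ u ∷ ts  ↭⟨ prep v (balance C) ⟩
        v ∷ map proj₂ (used C) ++ ss      ∎
    }
    where open PermutationReasoning

  -- Cancelling a used edge from `v` to `u` removes a tail `v` and a head `u`; this too moves the
  -- sink from `u` to `v`.
  backward : ∀ {ss ts u v} (C : FlowBetween ss (u ∷ ts)) {F} →
             used C ↭ (v , u) ∷ F → FlowBetween ss (v ∷ ts)
  backward {ss} {ts} {u} {v} C {F} p = record
    { used      = F
    ; unused    = (v , u) ∷ unused C
    ; partition = begin
        F ++ (v , u) ∷ unused C  ↭⟨ shift (v , u) F (unused C) ⟩
        (v , u) ∷ F ++ unused C  ↭⟨ ++⁺ʳ (unused C) p ⟨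
        used C ++ unused C       ↭⟨ partition C ⟩
        E                        ∎
    -- The lost head `u` is put back on both sides, where the old balance applies, and is cancelled
    -- at the end.
    ; balance   = drop-∷ (begin
        u ∷ map proj₁ F ++ v ∷ ts         ↭⟨ prep u (shift v (map proj₁ F) ts) ⟩
        u ∷ v ∷ map proj₁ F ++ ts         ↭⟨ shift u (v ∷ map proj₁ F) ts ⟨
        v ∷ map proj₁ F ++ u ∷ ts         ↭⟨ ++⁺ʳ (u ∷ ts) (map⁺ proj₁ p) ⟨
        map proj₁ (used C) ++ u ∷ ts      ↭⟨ balance C ⟩
        map proj₂ (used C) ++ ss          ↭⟨ ++⁺ʳ ss (map⁺ proj₂ p) ⟩
        u ∷ map proj₂ F ++ ss             ∎)
    }
    where open PermutationReasoning

  -- Augmenting walks and maximum flow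

  module MaxFlow (S T : List V) (m : ℕ)
    (cut-bound : (f : V → Bool) → (∀ {s} → s ∈ S → f s ≡ true) →
                 (∀ {t} → t ∈ T → f t ≡ false) → m ≤ ∑ E (⟦_⟧ ∘ cutEdge f)) where

    Inside : List V → Edge → Set
    Inside A (u , v) = u ∈ A × v ∈ A

    -- `sources` and `sinks` may repeat vertices: only edges have capacities, and several paths may
    -- share an end.
    record FlowOf (k : ℕ) : Set where
      field
        sources sinks : List V
        sources⊆S     : All (_∈ S) sources
        sinks⊆T       : All (_∈ T) sinks
        value         : length sources ≡ k
        flowBetween   : FlowBetween sources sinks

    module _ {ss ts : List V} (C : FlowBetween ss ts) where

      -- An augmenting walk from S to v inside A is recorded only by its result.  Since edges
      -- not inside A keep their state, a step to a new vertex is still legal after the walk.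
      record Reached (A : List V) (v : V) : Set where
        field
          origin   : V
          origin∈S : origin ∈ S
          moved    : FlowBetween (origin ∷ ss) (v ∷ ts)
          used⊆    : ∀ {e} → ¬ Inside A e → e ∈ used C → e ∈ used moved
          unused⊆  : ∀ {e} → ¬ Inside A e → e ∈ unused C → e ∈ unused moved

      open Reached

      weaken : ∀ {A v w} → Reached A v → Reached (w ∷ A) v
      weaken r = record
        { origin   = origin r
        ; origin∈S = origin∈S r
        ; moved    = moved r
        ; used⊆    = λ ¬in → used⊆ r (λ (a , b) → ¬in (there a , there b))
        ; unused⊆  = λ ¬in → unused⊆ r (λ (a , b) → ¬in (there a , there b))
        }

      -- This is the walk of length zero: `s` enters as source and sink at once, and no edge changes
      -- state.
      reached-source : ∀ {s} → s ∈ S → Reached S s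
      reached-source {s} s∈S = record
        { origin   = s
        ; origin∈S = s∈S
        ; moved    = record
            { used      = used C
            ; unused    = unused C
            ; partition = partition C
            ; balance   = begin
                map proj₁ (used C) ++ s ∷ ts  ↭⟨ shift s (map proj₁ (used C)) ts ⟩
                s ∷ map proj₁ (used C) ++ ts  ↭⟨ prep s (balance C) ⟩
                s ∷ map proj₂ (used C) ++ ss  ↭⟨ shift s (map proj₂ (used C)) ss ⟨
                map proj₂ (used C) ++ s ∷ ss  ∎
            }
        ; used⊆    = λ _ e∈ → e∈
        ; unused⊆  = λ _ e∈ → e∈
        }
        where open PermutationReasoning

      reach-forward : ∀ {A u v} → Reached A u → u ∈ A → v ∉ A →
                      (u , v) ∈ unused C → Reached (v ∷ A) v
      reach-forward {A} {u} {v} r u∈A v∉A e∈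
        with ∈⇒↭ (unused⊆ r (v∉A ∘ proj₂) e∈)
      ... | U , p = record
        { origin   = origin r
        ; origin∈S = origin∈S r
        ; moved    = forward (moved r) p
        ; used⊆    = λ ¬in → there ∘ used⊆ (weaken r) ¬in
        ; unused⊆  = λ ¬in x∈ → other ¬in (∈-resp-↭ p (unused⊆ (weaken r) ¬in x∈))
        }
        where
        other : ∀ {x} → ¬ Inside (v ∷ A) x → x ∈ (u , v) ∷ U → x ∈ U
        other ¬in (here refl) = ⊥-elim (¬in (there u∈A , here refl))
        other ¬in (there x∈)  = x∈

      reach-backward : ∀ {A u v} → Reached A u → u ∈ A → v ∉ A →
                       (v , u) ∈ used C → Reached (v ∷ A) v
      reach-backward {A} {u} {v} r u∈A v∉A e∈
        with ∈⇒↭ (used⊆ r (v∉A ∘ proj₁) e∈)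
      ... | F , p = record
        { origin   = origin r
        ; origin∈S = origin∈S r
        ; moved    = backward (moved r) p
        ; used⊆    = λ ¬in x∈ → other ¬in (∈-resp-↭ p (used⊆ (weaken r) ¬in x∈))
        ; unused⊆  = λ ¬in → there ∘ unused⊆ (weaken r) ¬in
        }
        where
        other : ∀ {x} → ¬ Inside (v ∷ A) x → x ∈ (v , u) ∷ F → x ∈ F
        other ¬in (here refl) = ⊥-elim (¬in (here refl , there u∈A))
        other ¬in (there x∈)  = x∈

      record ReachedSet (A : List V) : Set where
        field
          S⊆A     : ∀ {s} → s ∈ S → s ∈ A
          reached : ∀ {v} → v ∈ A → Reached A v

      -- No edge of the residual graph of `C` leaves `A`. The reference is the original flow `C`,
      -- not any of the moved flows.
      record Closed (A : List V) : Set where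
        field
          unused-closed : ∀ {u v} → (u , v) ∈ unused C → u ∈ A → v ∈ A
          used-closed   : ∀ {u v} → (u , v) ∈ used C → v ∈ A → u ∈ A

      open ReachedSet
      open Closed

      insert : ∀ {A v} → ReachedSet A → Reached (v ∷ A) v → ReachedSet (v ∷ A)
      insert R r = record
        { S⊆A     = there ∘ S⊆A R
        ; reached = λ { (here refl) → r ; (there w∈A) → weaken (reached R w∈A) }
        }

      expand : ∀ {A} → ReachedSet A → (∃[ v ] v ∉ A × Reached (v ∷ A) v) ⊎ Closed A
      expand {A} R
        with any? (λ (u , v) → (u ∈? A) ×-dec ¬? (v ∈? A)) (unused C)
           | any? (λ (u , v) → (v ∈? A) ×-dec ¬? (u ∈? A)) (used C)
      ... | yes fwd | _       = let (u , v) , e∈ , u∈A , v∉A = find fwd in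
        inj₁ (v , v∉A , reach-forward (reached R u∈A) u∈A v∉A e∈)
      ... | no _    | yes bwd = let (v , u) , e∈ , u∈A , v∉A = find bwd in
        inj₁ (v , v∉A , reach-backward (reached R u∈A) u∈A v∉A e∈)
      ... | no ¬fwd | no ¬bwd = inj₂ record
        { unused-closed = λ {u} {v} e∈ u∈A → decidable-stable (v ∈? A)
            (λ v∉A → ¬fwd (lose e∈ (u∈A , v∉A)))
        ; used-closed   = λ {u} {v} e∈ v∈A → decidable-stable (u ∈? A)
            (λ u∉A → ¬bwd (lose e∈ (v∈A , u∉A)))
        }

      -- B lists the candidates that may still be outside A; it shrinks at every step.
      search : ∀ n {A B} → length B ≤ n → (∀ {v} → v ∉ A → v ∈ B) →
               ReachedSet A → ∃[ A′ ] ReachedSet A′ × Closed A′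
      search n {A} {B} B≤n cover R with expand R
      ... | inj₂ closed = A , R , closed
      ... | inj₁ (v , v∉A , r) with ∈⇒↭ (cover v∉A)
      ...   | B′ , p with n | subst (_≤ n) (↭-length p) B≤n
      ...     | suc n′ | s≤s B′≤n′ = search n′ B′≤n′ cover′ (insert R r)
        where
        cover′ : ∀ {w} → w ∉ v ∷ A → w ∈ B′
        cover′ w∉ with ∈-resp-↭ p (cover (w∉ ∘ there))
        ... | here refl  = ⊥-elim (w∉ (here refl))
        ... | there w∈B′ = w∈B′

      closure : ∃[ A ] ReachedSet A × Closed A
      closure = search (length vertices) ≤-refl (λ {v} _ → complete v)
                  record { S⊆A = λ s∈S → s∈S ; reached = reached-source }

      cut-value : ∀ {A} → All (_∈ A) ss → All (_∉ A) ts → Closed A →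
                  ∑ E (⟦_⟧ ∘ cutEdge (λ v → does (v ∈? A))) ≡ length ss
      cut-value {A} ss⊆A ts∉A cl = +-cancelˡ-≡ (∑ F (χ ∘ proj₂)) _ _ (begin
        ∑ F (χ ∘ proj₂) + ∑ E cut                  ≡⟨ cong (∑ F (χ ∘ proj₂) +_) ∑E≡∑F ⟩
        ∑ F (χ ∘ proj₂) + ∑ F cut                  ≡⟨ ∑-+ (χ ∘ proj₂) cut F ⟨
        ∑ F (λ e → χ (proj₂ e) + cut e)            ≡⟨ ∑-cong (All.tabulate used-eq) ⟩
        ∑ F (χ ∘ proj₁)                            ≡⟨ ∑-map χ proj₁ F ⟨
        ∑ (map proj₁ F) χ                          ≡⟨ +-identityʳ _ ⟨
        ∑ (map proj₁ F) χ + 0                      ≡⟨ cong (∑ (map proj₁ F) χ +_) ts-zero ⟨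
        ∑ (map proj₁ F) χ + ∑ ts χ                 ≡⟨ ∑-++ χ (map proj₁ F) ts ⟨
        ∑ (map proj₁ F ++ ts) χ                    ≡⟨ ∑-↭ χ (balance C) ⟩
        ∑ (map proj₂ F ++ ss) χ                    ≡⟨ ∑-++ χ (map proj₂ F) ss ⟩
        ∑ (map proj₂ F) χ + ∑ ss χ                 ≡⟨ cong₂ _+_ (∑-map χ proj₂ F) ss-one ⟩
        ∑ F (χ ∘ proj₂) + length ss                ∎)
        where
        open ≡-Reasoning
        F : List Edge
        F = used C
        f : V → Bool
        f v = does (v ∈? A)
        χ : V → ℕ
        χ = ⟦_⟧ ∘ f
        cut : Edge → ℕ
        cut = ⟦_⟧ ∘ cutEdge f
        ts-zero : ∑ ts χ ≡ 0
        ts-zero = ∑-zero (All.map (λ {v} v∉A → cong ⟦_⟧ (dec-false (v ∈? A) v∉A)) ts∉A)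
        ss-one : ∑ ss χ ≡ length ss
        ss-one = ∑-one (All.map (λ {v} v∈A → cong ⟦_⟧ (dec-true (v ∈? A) v∈A)) ss⊆A)
        used-eq : ∀ {e} → e ∈ F → χ (proj₂ e) + cut e ≡ χ (proj₁ e)
        used-eq {u , v} e∈ with u ∈? A | v ∈? A
        ... | yes _  | yes _  = refl
        ... | yes _  | no _   = refl
        ... | no u∉A | yes v∈A = ⊥-elim (u∉A (used-closed cl e∈ v∈A))
        ... | no _   | no _   = refl
        unused-zero : ∀ {e} → e ∈ unused C → cut e ≡ 0
        unused-zero {u , v} e∈ with u ∈? A | v ∈? A
        ... | yes _   | yes _  = refl
        ... | yes u∈A | no v∉A = ⊥-elim (v∉A (unused-closed cl e∈ u∈A))
        ... | no _    | _      = refl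
        ∑E≡∑F : ∑ E cut ≡ ∑ F cut
        ∑E≡∑F = begin
          ∑ E cut                       ≡⟨ ∑-↭ cut (partition C) ⟨
          ∑ (F ++ unused C) cut         ≡⟨ ∑-++ cut F (unused C) ⟩
          ∑ F cut + ∑ (unused C) cut    ≡⟨ cong (∑ F cut +_) (∑-zero (All.tabulate unused-zero)) ⟩
          ∑ F cut + 0                   ≡⟨ +-identityʳ _ ⟩
          ∑ F cut                       ∎

    -- If the closed set meets `T`, the walk ending there already yields a flow with one more source
    -- and sink. Otherwise its indicator is an admissible cut with exactly `k` edges, contradicting
    -- `k < m`.
    augment : ∀ {k} → k < m → FlowOf k → FlowOf (suc k)
    augment {k} k<m Φ = extend (closure flowBetween)
      where
      open FlowOf Φ
      extend : ∃[ A ] ReachedSet flowBetween A × Closed flowBetween A → FlowOf (suc k)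
      extend (A , R , cl) with any? (_∈? A) T
      ... | yes hit = let t , t∈T , t∈A = find hit ; r = reached R t∈A in record
        { sources     = origin r ∷ sources
        ; sinks       = t ∷ sinks
        ; sources⊆S   = origin∈S r ∷ sources⊆S
        ; sinks⊆T     = t∈T ∷ sinks⊆T
        ; value       = cong suc value
        ; flowBetween = moved r
        }
        where
        open ReachedSet
        open Reached
      ... | no miss = ⊥-elim (<⇒≱ k<m (begin
        m                                          ≤⟨ cut-bound f f-S f-T ⟩
        ∑ E (⟦_⟧ ∘ cutEdge f)                      ≡⟨ cut-value flowBetween (All.map S⊆A sources⊆S) (All.map T∉A sinks⊆T) cl ⟩
        length sources                             ≡⟨ value ⟩
        k                                          ∎))
        where
        open ≤-Reasoning
        open ReachedSet R using (S⊆A)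
        f : V → Bool
        f v = does (v ∈? A)
        T∉A : ∀ {t} → t ∈ T → t ∉ A
        T∉A t∈T t∈A = miss (lose t∈T t∈A)
        f-S : ∀ {s} → s ∈ S → f s ≡ true
        f-S {s} s∈S = dec-true (s ∈? A) (S⊆A s∈S)
        f-T : ∀ {t} → t ∈ T → f t ≡ false
        f-T {t} t∈T = dec-false (t ∈? A) (T∉A t∈T)

    flow : ∀ k → k ≤ m → FlowOf k
    flow zero    _   = record
      { sources = [] ; sinks = [] ; sources⊆S = [] ; sinks⊆T = [] ; value = refl
      ; flowBetween = record { used = [] ; unused = E ; partition = ↭-refl ; balance = ↭-refl }
      }
    flow (suc k) k<m = augment k<m (flow k (<⇒≤ k<m))

    maxFlow : FlowOf m
    maxFlow = flow m ≤-refl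

-- Decomposition of flows into paths

module _ {d : ℕ} where

  IsEdge : Vertex d × Vertex d → Set
  IsEdge (u , v) = DEdge u v

  record Extraction (F : List (Vertex d × Vertex d)) (s : Vertex d) (ss ts : List (Vertex d)) : Set where
    field
      {t}     : Vertex d
      path    : Path s t
      F′      : List (Vertex d × Vertex d)
      ts′     : List (Vertex d)
      ts↭     : ts ↭ t ∷ ts′
      F↭      : F ↭ edges path ++ F′
      balance : map proj₁ F′ ++ ts′ ↭ map proj₂ F′ ++ ss

  -- Starting from `s`, the path stops at a sink or follows a used edge to `v`. Deleting that edge
  -- leaves a balanced flow with `v` as source in place of `s`; the shrinking edge list, bounded by
  -- `n`, ensures termination.
  extractPath : ∀ n {F s ss ts} → length F ≤ n → All IsEdge F →
                map proj₁ F ++ ts ↭ map proj₂ F ++ s ∷ ss → Extraction F s ss ts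
  extractPath n {F} {s} {ss} {ts} F≤n edgesF bal
    -- The source `s` occurs on the right of the balance, hence on the left: as a sink or as the
    -- tail of a used edge.
    with ∈-++⁻ (map proj₁ F) (∈-resp-↭ (↭-sym bal) (∈-++⁺ʳ (map proj₂ F) (here refl)))
  ... | inj₂ s∈ts with ∈⇒↭ s∈ts
  ...   | ts′ , p = record
    { path    = [ s ]
    ; F′      = F
    ; ts′     = ts′
    ; ts↭     = p
    ; F↭      = ↭-refl
    ; balance = drop-∷ (begin
        s ∷ map proj₁ F ++ ts′   ↭⟨ shift s (map proj₁ F) ts′ ⟨
        map proj₁ F ++ s ∷ ts′   ↭⟨ ++⁺ˡ (map proj₁ F) p ⟨
        map proj₁ F ++ ts        ↭⟨ bal ⟩
        map proj₂ F ++ s ∷ ss    ↭⟨ shift s (map proj₂ F) ss ⟩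
        s ∷ map proj₂ F ++ ss    ∎)
    }
    where open PermutationReasoning
  extractPath n {F} {s} {ss} {ts} F≤n edgesF bal | inj₁ s∈srcs with ∈-map⁻ proj₁ s∈srcs
  ... | (.s , v) , e∈F , refl with ∈⇒↭ e∈F
  ...   | G , p with n | subst (_≤ n) (↭-length p) F≤n | All-resp-↭ p edgesF
  ...     | suc n′ | s≤s G≤n′ | e ∷ edgesG = record
    { path    = e ▸ path
    ; F′      = F′
    ; ts′     = ts′
    ; ts↭     = ts↭
    ; F↭      = ↭-trans p (prep (s , v) F↭)
    ; balance = balance
    }
    where
    open PermutationReasoning
    open Extraction (extractPath n′ {G} {v} {ss} {ts} G≤n′ edgesG (drop-∷ (begin
        s ∷ map proj₁ G ++ ts        ↭⟨ ++⁺ʳ ts (map⁺ proj₁ p) ⟨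
        map proj₁ F ++ ts            ↭⟨ bal ⟩
        map proj₂ F ++ s ∷ ss        ↭⟨ ++⁺ʳ (s ∷ ss) (map⁺ proj₂ p) ⟩
        v ∷ map proj₂ G ++ s ∷ ss    ↭⟨ shift s (v ∷ map proj₂ G) ss ⟩
        s ∷ v ∷ map proj₂ G ++ ss    ↭⟨ prep s (shift v (map proj₂ G) ss) ⟨
        s ∷ map proj₂ G ++ v ∷ ss    ∎)))

  decompose : ∀ {S T : List (Vertex d)} ss {F ts} → All (_∈ S) ss → All (_∈ T) ts → All IsEdge F →
              map proj₁ F ++ ts ↭ map proj₂ F ++ ss →
              Σ (List (SomePath d)) λ ps → ∃[ F′ ]
                length ps ≡ length ss ×
                All (λ p → start p ∈ S × end p ∈ T) ps ×
                F ↭ concat (map pathEdges ps) ++ F′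
  -- With all sources served, whatever edges remain are left over in `F′`.
  decompose []       {F} _ _ _ _ = [] , F , refl , [] , ↭-refl
  decompose (s ∷ ss) {F} (s∈S ∷ ss⊆S) ts⊆T edgesF bal
    with extractPath (length F) ≤-refl edgesF bal
  ... | X with All-resp-↭ (Extraction.ts↭ X) ts⊆T
  ...   | t∈T ∷ ts′⊆T
    with decompose ss ss⊆S ts′⊆T
           (All.++⁻ʳ (edges (Extraction.path X)) (All-resp-↭ (Extraction.F↭ X) edgesF))
           (Extraction.balance X)
  ...     | ps , F″ , len , ends , p =
    (s , t , path) ∷ ps , F″ , cong suc len , (s∈S , t∈T) ∷ ends , (begin
      F                                                      ↭⟨ F↭ ⟩
      edges path ++ F′                                       ↭⟨ ++⁺ˡ (edges path) p ⟩
      edges path ++ concat (map pathEdges ps) ++ F″          ↭⟨ ++-assoc (edges path) _ F″ ⟨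
      (edges path ++ concat (map pathEdges ps)) ++ F″        ∎)
    where
    open PermutationReasoning
    open Extraction X

-- The hypercube

_≼_ : ∀ {d} → Vertex d → Vertex d → Set
x ≼ y = ∀ i → lookup x i Bool.≤ lookup y i

vertices : ∀ d → List (Vertex d)
vertices zero    = [] ∷ []
vertices (suc d) = map (false ∷_) (vertices d) ++ map (true ∷_) (vertices d)

∈-vertices : ∀ {d} (v : Vertex d) → v ∈ vertices d
∈-vertices []          = here refl
∈-vertices (false ∷ v) = ∈-++⁺ˡ (∈-map⁺ (false ∷_) (∈-vertices v))
∈-vertices (true ∷ v)  = ∈-++⁺ʳ (map (false ∷_) (vertices _)) (∈-map⁺ (true ∷_) (∈-vertices v))

lift : ∀ {d} → Bool → Vertex d × Vertex d → Vertex (suc d) × Vertex (suc d)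
lift b (u , v) = b ∷ u , b ∷ v

across : ∀ {d} → Vertex d → Vertex (suc d) × Vertex (suc d)
across v = false ∷ v , true ∷ v

cubeEdges : ∀ d → List (Vertex d × Vertex d)
cubeEdges zero    = []
cubeEdges (suc d) =
  map (lift false) (cubeEdges d) ++ map (lift true) (cubeEdges d) ++ map across (vertices d)

cubeEdges-areEdges : ∀ d → All IsEdge (cubeEdges d)
cubeEdges-areEdges zero    = []
cubeEdges-areEdges (suc d) =
  All.++⁺ (All.map⁺ (All.map lifted (cubeEdges-areEdges d)))
    (All.++⁺ (All.map⁺ (All.map lifted (cubeEdges-areEdges d)))
      (All.map⁺ (All.universal (λ v → zero , refl , refl) (vertices d))))
  where
  lifted : ∀ {b} {e : Vertex d × Vertex d} → IsEdge e → IsEdge (lift b e)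
  lifted (i , xᵢ , refl) = suc i , xᵢ , refl

vertices-unique : ∀ d → Unique (vertices d)
vertices-unique zero    = [] ∷ []
vertices-unique (suc d) =
  Unique.++⁺ (Unique.map⁺ Vec.∷-injectiveʳ (vertices-unique d))
             (Unique.map⁺ Vec.∷-injectiveʳ (vertices-unique d)) disjoint
  where
  disjoint : ∀ {v} → v ∈ map (false ∷_) (vertices d) × v ∈ map (true ∷_) (vertices d) → ⊥
  disjoint (p , q) with ∈-map⁻ (false ∷_) p | ∈-map⁻ (true ∷_) q
  ... | _ , _ , refl | _ , _ , ()

cubeEdges-unique : ∀ d → Unique (cubeEdges d)
cubeEdges-unique zero    = []
cubeEdges-unique (suc d) =
  Unique.++⁺ (Unique.map⁺ lift-injective (cubeEdges-unique d))
    (Unique.++⁺ (Unique.map⁺ lift-injective (cubeEdges-unique d))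
      (Unique.map⁺ (λ { refl → refl }) (vertices-unique d)) disjoint₁)
    disjoint₀
  where
  lift-injective : ∀ {b} {e e′ : Vertex d × Vertex d} → lift b e ≡ lift b e′ → e ≡ e′
  lift-injective refl = refl
  disjoint₁ : ∀ {e} → e ∈ map (lift true) (cubeEdges d) × e ∈ map across (vertices d) → ⊥
  disjoint₁ (p , q) with ∈-map⁻ (lift true) p | ∈-map⁻ across q
  ... | _ , _ , refl | _ , _ , ()
  disjoint₀ : ∀ {e} → e ∈ map (lift false) (cubeEdges d) ×
              e ∈ map (lift true) (cubeEdges d) ++ map across (vertices d) → ⊥
  disjoint₀ (p , q) with ∈-map⁻ (lift false) p | ∈-++⁻ (map (lift true) (cubeEdges d)) q
  ... | _ , _ , refl | inj₁ q₁ with ∈-map⁻ (lift true) q₁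
  ...   | _ , _ , ()
  disjoint₀ (p , q) | _ , _ , refl | inj₂ q₂ with ∈-map⁻ across q₂
  ...   | _ , _ , ()

_≟ᵛ_ : ∀ {d} → DecidableEquality (Vertex d)
_≟ᵛ_ = Vec.≡-dec Bool._≟_

-- The directed cut bound

-- This unfolds to the size of the cut given by `f`, the quantity in `cut-bound` for
-- `E = cubeEdges d`.
drops : ∀ {d} → (Vertex d → Bool) → ℕ
drops {d} f = ∑ (cubeEdges d) (λ (u , v) → ⟦ f u ∧ not (f v) ⟧)

dist : ∀ {d} → (Vertex d → Bool) → (Vertex d → Bool) → ℕ
dist {d} f g = ∑ (vertices d) (λ v → ⟦ f v xor g v ⟧)

Monotone : ∀ {d} → (Vertex d → Bool) → Set
Monotone g = ∀ x y → x ≼ y → g x Bool.≤ g y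

half : ∀ {d} → Bool → (Vertex (suc d) → Bool) → Vertex d → Bool
half b f v = f (b ∷ v)

glue : ∀ {d} → (Vertex d → Bool) → (Vertex d → Bool) → Vertex (suc d) → Bool
glue g₀ g₁ (false ∷ v) = g₀ v
glue g₀ g₁ (true ∷ v)  = g₁ v

glue-monotone : ∀ {d} {g₀ g₁ : Vertex d → Bool} → Monotone g₀ → Monotone g₁ →
                (∀ v → g₀ v Bool.≤ g₁ v) → Monotone (glue g₀ g₁)
glue-monotone m₀ m₁ le (false ∷ x) (false ∷ y) x≼y = m₀ x y (x≼y ∘ suc)
glue-monotone m₀ m₁ le (false ∷ x) (true ∷ y)  x≼y = Bool.≤-trans (le x) (m₁ x y (x≼y ∘ suc))
glue-monotone m₀ m₁ le (true ∷ x)  (true ∷ y)  x≼y = m₁ x y (x≼y ∘ suc)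
glue-monotone m₀ m₁ le (true ∷ x)  (false ∷ y) x≼y with x≼y zero
... | ()

drops-suc : ∀ {d} (f : Vertex (suc d) → Bool) →
            drops f ≡ drops (half false f) + drops (half true f)
                      + ∑ (vertices d) (λ v → ⟦ half false f v ∧ not (half true f v) ⟧)
drops-suc {d} f = begin
  drops f
    ≡⟨ ∑-++ c (map (lift false) (cubeEdges d)) _ ⟩
  ∑ (map (lift false) (cubeEdges d)) c + ∑ (map (lift true) (cubeEdges d) ++ map across (vertices d)) c
    ≡⟨ cong₂ _+_ (∑-map c (lift false) (cubeEdges d)) (∑-++ c (map (lift true) (cubeEdges d)) _) ⟩
  drops (half false f) + (∑ (map (lift true) (cubeEdges d)) c + ∑ (map across (vertices d)) c)
    ≡⟨ cong (drops (half false f) +_) (cong₂ _+_ (∑-map c (lift true) (cubeEdges d)) (∑-map c across (vertices d))) ⟩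
  drops (half false f) + (drops (half true f) + ∑ (vertices d) (c ∘ across))
    ≡⟨ +-assoc (drops (half false f)) _ _ ⟨
  drops (half false f) + drops (half true f) + ∑ (vertices d) (c ∘ across)
    ∎
  where
  open ≡-Reasoning
  c : Vertex (suc d) × Vertex (suc d) → ℕ
  c (u , v) = ⟦ f u ∧ not (f v) ⟧

dist-glue : ∀ {d} (f : Vertex (suc d) → Bool) (g₀ g₁ : Vertex d → Bool) →
            dist f (glue g₀ g₁) ≡ dist (half false f) g₀ + dist (half true f) g₁
dist-glue {d} f g₀ g₁ =
  trans (∑-++ h (map (false ∷_) (vertices d)) _)
        (cong₂ _+_ (∑-map h (false ∷_) (vertices d)) (∑-map h (true ∷_) (vertices d)))
  where
  h : Vertex (suc d) → ℕ
  h v = ⟦ f v xor glue g₀ g₁ v ⟧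

-- Unless `g₀` is true and `g₁` false, both candidates agree with `g₀` and `g₁`. In that exceptional
-- case the left side is 2, and so much is available on the right: `g₀` or `g₁` is wrong already, or
-- `f₀ ∧ not f₁` holds.
errors-pointwise : ∀ f₀ f₁ g₀ g₁ →
  (⟦ f₀ xor (g₀ ∧ g₁) ⟧ + ⟦ f₁ xor g₁ ⟧) + (⟦ f₀ xor g₀ ⟧ + ⟦ f₁ xor (g₀ ∨ g₁) ⟧)
  ≤ let b = (⟦ f₀ xor g₀ ⟧ + ⟦ f₁ xor g₁ ⟧) + ⟦ f₀ ∧ not f₁ ⟧ in b + b
errors-pointwise f₀ f₁ g₀ g₁ = ≤ᵇ⇒≤ _ _ (table f₀ f₁ g₀ g₁)
  where
  table : ∀ f₀ f₁ g₀ g₁ → Bool.T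
    ((⟦ f₀ xor (g₀ ∧ g₁) ⟧ + ⟦ f₁ xor g₁ ⟧) + (⟦ f₀ xor g₀ ⟧ + ⟦ f₁ xor (g₀ ∨ g₁) ⟧)
     ≤ᵇ (let b = (⟦ f₀ xor g₀ ⟧ + ⟦ f₁ xor g₁ ⟧) + ⟦ f₀ ∧ not f₁ ⟧ in b + b))
  table false false false false = _
  table false false false true  = _
  table false false true  false = _
  table false false true  true  = _
  table false true  false false = _
  table false true  false true  = _
  table false true  true  false = _
  table false true  true  true  = _
  table true  false false false = _
  table true  false false true  = _
  table true  false true  false = _
  table true  false true  true  = _
  table true  true  false false = _
  table true  true  false true  = _
  table true  true  true  false = _
  table true  true  true  true  = _


-- By averaging, one of the two candidates stays within the error budget.
m+n≤o+o⇒m≤o⊎n≤o : ∀ {m n o} → m + n ≤ o + o → m ≤ o ⊎ n ≤ o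
m+n≤o+o⇒m≤o⊎n≤o {m} {n} {o} le with m ≤? o | n ≤? o
... | yes m≤o | _       = inj₁ m≤o
... | no _    | yes n≤o = inj₂ n≤o
... | no m≰o  | no n≰o  = ⊥-elim (<⇒≱ (+-mono-< (≰⇒> m≰o) (≰⇒> n≰o)) le)

monotone-approximation : ∀ d (f : Vertex d → Bool) → ∃[ g ] Monotone g × dist f g ≤ drops f
-- The cube of dimension 0 has no edges, so no error is allowed; on its single vertex `f` is
-- monotone.
monotone-approximation zero f = f , monotone , dist≤0
  where
  monotone : Monotone f
  monotone [] [] _ = b≤b
  dist≤0 : dist f f ≤ 0
  dist≤0 with f []
  ... | false = z≤n
  ... | true  = z≤n
monotone-approximation (suc d) f
  with monotone-approximation d (half false f) | monotone-approximation d (half true f)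
... | g₀ , m₀ , le₀ | g₁ , m₁ , le₁ = choose (m+n≤o+o⇒m≤o⊎n≤o errors)
  where
  open ≤-Reasoning
  f₀ f₁ : Vertex d → Bool
  f₀ = half false f
  f₁ = half true f

  g∧ g∨ : Vertex d → Bool
  g∧ v = g₀ v ∧ g₁ v
  g∨ v = g₀ v ∨ g₁ v

  δ : (Vertex d → Bool) → (Vertex d → Bool) → Vertex d → ℕ
  δ h g v = ⟦ h v xor g v ⟧

  c : Vertex d → ℕ
  c v = ⟦ f₀ v ∧ not (f₁ v) ⟧

  V : List (Vertex d)
  V = vertices d

  -- The budget for either candidate: the errors of the two halves plus the decreasing edges in the
  -- new direction.
  bound : ℕ
  bound = dist f₀ g₀ + dist f₁ g₁ + ∑ V c

  ∑-bound : ∑ V (λ v → δ f₀ g₀ v + δ f₁ g₁ v + c v) ≡ bound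
  ∑-bound = trans (∑-+ (λ v → δ f₀ g₀ v + δ f₁ g₁ v) c V)
                  (cong (_+ ∑ V c) (∑-+ (δ f₀ g₀) (δ f₁ g₁) V))

  errors : (dist f₀ g∧ + dist f₁ g₁) + (dist f₀ g₀ + dist f₁ g∨) ≤ bound + bound
  errors = begin
    (dist f₀ g∧ + dist f₁ g₁) + (dist f₀ g₀ + dist f₁ g∨)
      ≡⟨ cong₂ _+_ (∑-+ (δ f₀ g∧) (δ f₁ g₁) V) (∑-+ (δ f₀ g₀) (δ f₁ g∨) V) ⟨
    ∑ V (λ v → δ f₀ g∧ v + δ f₁ g₁ v) + ∑ V (λ v → δ f₀ g₀ v + δ f₁ g∨ v)
      ≡⟨ ∑-+ (λ v → δ f₀ g∧ v + δ f₁ g₁ v) (λ v → δ f₀ g₀ v + δ f₁ g∨ v) V ⟨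
    ∑ V (λ v → (δ f₀ g∧ v + δ f₁ g₁ v) + (δ f₀ g₀ v + δ f₁ g∨ v))
      ≤⟨ ∑-mono (All.universal (λ v → errors-pointwise (f₀ v) (f₁ v) (g₀ v) (g₁ v)) V) ⟩
    ∑ V (λ v → (δ f₀ g₀ v + δ f₁ g₁ v + c v) + (δ f₀ g₀ v + δ f₁ g₁ v + c v))
      ≡⟨ ∑-+ (λ v → δ f₀ g₀ v + δ f₁ g₁ v + c v) (λ v → δ f₀ g₀ v + δ f₁ g₁ v + c v) V ⟩
    ∑ V (λ v → δ f₀ g₀ v + δ f₁ g₁ v + c v) + ∑ V (λ v → δ f₀ g₀ v + δ f₁ g₁ v + c v)
      ≡⟨ cong₂ _+_ ∑-bound ∑-bound ⟩
    bound + bound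
      ∎

  glue-bound : ∀ h₀ h₁ → dist f₀ h₀ + dist f₁ h₁ ≤ bound → dist f (glue h₀ h₁) ≤ drops f
  glue-bound h₀ h₁ le = begin
    dist f (glue h₀ h₁)            ≡⟨ dist-glue f h₀ h₁ ⟩
    dist f₀ h₀ + dist f₁ h₁        ≤⟨ le ⟩
    -- The induction hypotheses for the two halves enter here.
    bound                          ≤⟨ +-monoˡ-≤ (∑ V c) (+-mono-≤ le₀ le₁) ⟩
    drops f₀ + drops f₁ + ∑ V c    ≡⟨ drops-suc f ⟨
    drops f                        ∎

  ∧-mono : ∀ {a b a′ b′} → a Bool.≤ a′ → b Bool.≤ b′ → (a ∧ b) Bool.≤ (a′ ∧ b′)
  ∧-mono {true}  b≤b q = q
  ∧-mono {false} _   _ = Bool.≤-minimum _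

  ∨-mono : ∀ {a b a′ b′} → a Bool.≤ a′ → b Bool.≤ b′ → (a ∨ b) Bool.≤ (a′ ∨ b′)
  ∨-mono {a′ = false} b≤b q = q
  ∨-mono {a′ = true}  _   _ = Bool.≤-maximum _

  ∧≤ʳ : ∀ a b → (a ∧ b) Bool.≤ b
  ∧≤ʳ false b = Bool.≤-minimum b
  ∧≤ʳ true  b = b≤b

  ≤∨ˡ : ∀ a b → a Bool.≤ (a ∨ b)
  ≤∨ˡ false b = Bool.≤-minimum b
  ≤∨ˡ true  b = b≤b

  choose : dist f₀ g∧ + dist f₁ g₁ ≤ bound ⊎ dist f₀ g₀ + dist f₁ g∨ ≤ bound →
           ∃[ g ] Monotone g × dist f g ≤ drops f
  choose (inj₁ le) = glue g∧ g₁
    , glue-monotone (λ x y p → ∧-mono (m₀ x y p) (m₁ x y p)) m₁ (λ v → ∧≤ʳ (g₀ v) (g₁ v))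
    , glue-bound g∧ g₁ le
  choose (inj₂ le) = glue g₀ g∨
    , glue-monotone m₀ (λ x y p → ∨-mono (m₀ x y p) (m₁ x y p)) (λ v → ≤∨ˡ (g₀ v) (g₁ v))
    , glue-bound g₀ g∨ le

-- Cuts separating a matched pair

-- `f` falls between the two points and `g` does not, so they disagree at the lower point if `gs` is
-- false and at the upper one if `gs` is true.
violation-error : ∀ {fs ft gs gt} → fs ≡ true → ft ≡ false → gs Bool.≤ gt →
                  1 ≤ ⟦ fs xor gs ⟧ + ⟦ ft xor gt ⟧
violation-error {gs = false} refl refl _   = s≤s z≤n
violation-error {gs = true}  refl refl b≤b = s≤s z≤n

module _ {d : ℕ} (M : MatchedPair d) (S∩T=∅ : Disjoint (MatchedPair.S M) (MatchedPair.T M)) where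
  open MatchedPair M

  -- Every pair `s`, `φ s` contains an error of the monotone approximation `g`, and `g` has at most
  -- `drops f` errors in all.
  matching≤drops : (f : Vertex d → Bool) → (∀ {s} → s ∈ S → f s ≡ true) →
                   (∀ {t} → t ∈ T → f t ≡ false) → length S ≤ drops f
  matching≤drops f f-S f-T with monotone-approximation d f
  ... | g , mono , le = begin
    length S                               ≡⟨ ∑-one {h = λ _ → 1} (All.universal (λ _ → refl) S) ⟨
    ∑ S (λ _ → 1)                          ≤⟨ ∑-mono (All.tabulate error) ⟩
    ∑ S (λ s → δ s + δ (φ s))              ≡⟨ ∑-+ δ (δ ∘ φ) S ⟩
    ∑ S δ + ∑ S (δ ∘ φ)                    ≡⟨ cong (∑ S δ +_) (∑-map δ φ S) ⟨
    ∑ S δ + ∑ T δ                          ≡⟨ ∑-++ δ S T ⟨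
    -- As `S` and `T` are disjoint and duplicate-free, no error is counted for two pairs.
    ∑ (S ++ T) δ                           ≤⟨ ∑-⊆ δ S++T-unique (λ {v} _ → ∈-vertices v) ⟩
    dist f g                               ≤⟨ le ⟩
    drops f                                ∎
    where
    open ≤-Reasoning
    δ : Vertex d → ℕ
    δ v = ⟦ f v xor g v ⟧
    error : ∀ {s} → s ∈ S → 1 ≤ δ s + δ (φ s)
    error {s} s∈S = violation-error (f-S s∈S) (f-T (∈-map⁺ φ s∈S))
      (mono s (φ s) (proj₂ (All.lookup φ-above s∈S)))
    S++T-unique : Unique (S ++ T)
    S++T-unique = Unique.++⁺ S-set φ-inj (λ (p , q) → S∩T=∅ p q)

theorem4p12 : (d : ℕ) → d ≥ 1 → (M : MatchedPair d) →
    Disjoint (MatchedPair.S M) (MatchedPair.T M) →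
    Σ (List (SomePath d)) λ ps →
    (length ps ≡ length (MatchedPair.S M)) ×
    All (λ p → (start p ∈ MatchedPair.S M) × (end p ∈ MatchedPair.T M)) ps ×
    EdgeDisjoint ps
theorem4p12 d _ M S∩T=∅ = conclude (decompose sources sources⊆S sinks⊆T used-edges (balance flowBetween))
  where
  open MatchedPair M using (S; T)
  open Flow _≟ᵛ_ (vertices d) ∈-vertices (cubeEdges d)
  open FlowBetween
  -- The cut bound allows the flow value `length S`, which becomes the number of paths.
  open MaxFlow S T (length S) (matching≤drops M S∩T=∅)
  open FlowOf maxFlow

  used-edges : All IsEdge (used flowBetween)
  used-edges = All.++⁻ˡ (used flowBetween)
    (All-resp-↭ (↭-sym (partition flowBetween)) (cubeEdges-areEdges d))

  unique-resp-↭ : ∀ {xs ys : List Edge} → xs ↭ ys → Unique xs → Unique ys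
  unique-resp-↭ p = Unique-resp-↭ (setoid Edge) (↭⇒↭ₛ p)

  unique-++⁻ˡ : ∀ (xs : List Edge) {ys} → Unique (xs ++ ys) → Unique xs
  unique-++⁻ˡ []       _        = []
  unique-++⁻ˡ (x ∷ xs) (x≢ ∷ u) = All.++⁻ˡ xs x≢ ∷ unique-++⁻ˡ xs u

  used-unique : Unique (used flowBetween)
  used-unique = unique-++⁻ˡ (used flowBetween)
    (unique-resp-↭ (↭-sym (partition flowBetween)) (cubeEdges-unique d))

  conclude : (Σ (List (SomePath d)) λ ps → ∃[ F′ ]
                length ps ≡ length sources ×
                All (λ p → start p ∈ S × end p ∈ T) ps ×
                used flowBetween ↭ concat (map pathEdges ps) ++ F′) →
             Σ (List (SomePath d)) λ ps →
               length ps ≡ length S × All (λ p → start p ∈ S × end p ∈ T) ps × EdgeDisjoint ps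
  conclude (ps , F′ , len , ends , p) =
    -- Up to permutation, the edges of all paths form a part of `used`, itself a part of the
    -- duplicate-free `cubeEdges d`.
    ps , trans len value , ends , unique-++⁻ˡ _ (unique-resp-↭ p used-unique)
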